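{- Let $q$ be a prime power, let $s\ge1$ be an integer, let $F$ be a global function field with full constant field $\mathbb{F}_q$ and genus $g$, and let $P_\infty,P_1,\ldots,P_s$ be $s+1$ distinct places of $F$ with $\deg(P_\infty)=1$. Put $e_i=\deg(P_i)$ for $1\le i\le s$ and $v=\mathrm{lcm}(e_1,\ldots,e_s)$. Let $C^{(1)},\ldots,C^{(s)}\in\mathbb{F}_q^{\mathbb{N}\times\mathbb{N}_0}$ be the generating matrices given by the refined columnwise construction (described in the context). Then for all $1\le i\le s$ and all $d\in\mathbb{N}$, the length of the $d$th row of $C^{(i)}$ is at most $$g+sv\left\lfloor\frac{d-1}{v}\right\rfloor+iv.$$
   Context: **Row length.** The length of a row $(c_0,c_1,\ldots)\in\mathbb{F}_q^{\mathbb{N}_0}$ with only finitely many nonzero entries is $\max\{l\in\mathbb{N}:c_{l-1}\ne0\}$, and it is $0$ if all $c_r=0$. (Part of the assertion is that each row has only finitely many nonzero entries.) Rows are numbered $1,2,\ldots$ and columns $0,1,\ldots$. **Refined columnwise construction.** For a divisor $D$ of $F$ let $\mathcal{L}(D)=\{f\in F^*:\mathrm{div}(f)+D\ge 0\}\cup\{0\}$ be the Riemann-Roch space and $\ell(D)$ its dimension over $\mathbb{F}_q$. The gap numbers of $P_\infty$ are the $g$ positive integers $n$ with $\ell(nP_\infty)=\ell((n-1)P_\infty)$. Let $n_0<n_1<\cdots$ be the elements of $\mathbb{N}_0$ that are not gap numbers of $P_\infty$, in increasing order (so $n_r=r+g$ for $r\ge g$). Choose elements $y_r\in F$, $r\ge0$,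 as follows. - For $0\le r\le g$: any $y_r\in\mathcal{L}(n_rP_\infty)\setminus\mathcal{L}((n_r-1)P_\infty)$. - For $r>g$: determine integers $l_s,l_{s-1},\ldots,l_1\ge0$ by successive division with remainder: $w_{s+1}:=r-g$ and, for $i=s,s-1,\ldots,1$, $w_{i+1}=iv\,l_i+w_i$ with $w_i\in\{0,\ldots,iv-1\}$. Then choose any $y_r\in\mathcal{L}(D_r)\setminus\mathcal{L}(D_r')$, where $D_r=n_rP_\infty-\sum_{i=1}^s(l_i+l_{i+1}+\cdots+l_s)\frac{v}{e_i}P_i$ and $D_r'=n_{r-1}P_\infty-\sum_{i=1}^s(l_i+l_{i+1}+\cdots+l_s)\frac{v}{e_i}P_i$ (such a $y_r$ exists). For $1\le i\le s$ choose a local parameter $z_i$ at $P_i$ (i.e. $\nu_{P_i}(z_i)=1$) and write the local expansion of $y_r$ at $P_i$ as $y_r=\sum_{k=0}^\infty\beta^{(i)}_{k,r}z_i^k$ with $\beta^{(i)}_{k,r}\in\mathbb{F}_{q^{e_i}}$ (the residue class field of $P_i$; expansion in the completion of $F$ at $P_i$, identified with $\mathbb{F}_{q^{e_i}}((z_i))$). Using a fixed ordered basis of $\mathbb{F}_{q^{e_i}}/\mathbb{F}_q$, identify $\beta^{(i)}_{k,r}$ with a column vector $\boldsymbol{b}^{(i)}_{k,r}\in\mathbb{F}_q^{e_i}$. Column $r$ of $C^{(i)}=(c^{(i)}_{j,r})_{j\ge1,r\ge0}$ is the concatenation of $\boldsymbol{b}^{(i)}_{0,r},\boldsymbol{b}^{(i)}_{1,r},\ldots$;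 i.e. $c^{(i)}_{ke_i+h,r}$ is the $h$th coordinate of $\boldsymbol{b}^{(i)}_{k,r}$ for $k\ge0$, $1\le h\le e_i$. -}

module Defs where

open import Level using (Level; _⊔_) renaming (suc to lsuc)
open import Algebra using (CommutativeRing; RawRing)
import Algebra.Definitions as AlgebraicDefinitions
open import Algebra.Definitions.RawMonoid using (sum)
open import Algebra.Module using (RawLeftModule)
open import Algebra.Morphism.Structures using (module RingMorphisms)
import Algebra.Properties.Ring as RingProperties
open import Data.Empty using (⊥-elim)
open import Data.Fin using (Fin; zero; suc; toℕ; fromℕ; inject₁)
import Data.Fin.Properties as Fin
open import Data.Integer as ℤ using (ℤ; +_; -[1+_])
import Data.Integer.Properties as ℤ
open import Data.List using (List; []; _∷_; foldr; tabulate)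
open import Data.List.Relation.Unary.Any using (Any)
open import Data.Nat as ℕ using (ℕ; zero; suc; NonZero)
open import Data.Nat.DivMod using (_/_; _mod_)
open import Data.Nat.LCM using (lcm; gcd*lcm)
open import Data.Nat.GCD using (gcd)
open import Data.Nat.Primality using (Prime)
import Data.Nat.Properties as ℕ
open import Data.Product using (Σ-syntax; ∃-syntax; _×_; _,_; proj₁; proj₂)
open import Data.Sum using (_⊎_; inj₁; inj₂)
open import Data.Unit using (tt)
import Data.Vec.Functional as Vector
open import Function using (Inverse; _⇔_)
open import Relation.Binary using (Decidable)
import Relation.Binary.Construct.Add.Supremum.NonStrict as AddSupremum
open import Relation.Binary.PropositionalEquality as ≡ using (_≡_)
open import Relation.Nullary using (¬_; yes; no)
open import Relation.Nullary.Construct.Add.Supremum using (_⁺; ⊤⁺; [_])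
open import Relation.Unary using (Pred; _∈_; _∖_; U)

private
  variable
    a b c ℓ m ℓm p : Level

------------------------------------------------------------------------
-- Natural numbers

IsPrimePower : ℕ → Set
IsPrimePower q = ∃[ p ] ∃[ k ] Prime p × q ≡ p ℕ.^ suc k

lcms : ∀ {s} → (Fin s → ℕ) → ℕ
lcms = Vector.foldr lcm 1

lcm-nonZero : ∀ x y → NonZero x → NonZero y → NonZero (lcm x y)
lcm-nonZero x y x≢0 y≢0 = ℕ.≢-nonZero λ lcm≡0 → ℕ.≢-nonZero⁻¹ (x ℕ.* y) ⦃ ℕ.m*n≢0 x y ⦃ x≢0 ⦄ ⦃ y≢0 ⦄ ⦄
  (≡.trans (≡.sym (gcd*lcm x y)) (≡.trans (≡.cong (gcd x y ℕ.*_) lcm≡0) (ℕ.*-zeroʳ (gcd x y))))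

lcms-nonZero : ∀ {s} (e : Fin s → ℕ) → (∀ i → NonZero (e i)) → NonZero (lcms e)
lcms-nonZero {zero}  e e≢0 = _
lcms-nonZero {suc s} e e≢0 =
  lcm-nonZero (e zero) _ (e≢0 zero) (lcms-nonZero (λ i → e (suc i)) (λ i → e≢0 (suc i)))

-- Fin s is 0-based: l i and w (inject₁ i) are the l and w with index
-- suc (toℕ i), and w (fromℕ s) is the one with index s + 1.
record SuccessiveDivision (s v n : ℕ) : Set where
  field
    l        : Fin s → ℕ
    w        : Fin (suc s) → ℕ
    start    : w (fromℕ s) ≡ n
    step     : ∀ i → w (suc i) ≡ suc (toℕ i) ℕ.* v ℕ.* l i ℕ.+ w (inject₁ i)
    w-bound  : ∀ i → w (inject₁ i) ℕ.< suc (toℕ i) ℕ.* v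

-- The sum of l j over all j ≥ i.
tailSum : ∀ {s} → (Fin s → ℕ) → Fin s → ℕ
tailSum l zero    = Vector.foldr ℕ._+_ 0 l
tailSum l (suc i) = tailSum (Vector.tail l) i

------------------------------------------------------------------------
-- ℤ ∪ {∞}

open AddSupremum ℤ._≤_ public using (_≤⁺_; _≤⊤⁺; ≤⁺-trans) renaming ([_] to [_]≤)

infixl 6 _+⁺_

_+⁺_ : ℤ ⁺ → ℤ ⁺ → ℤ ⁺
[ x ] +⁺ [ y ] = [ x ℤ.+ y ]
[ x ] +⁺ ⊤⁺    = ⊤⁺
⊤⁺    +⁺ y     = ⊤⁺

------------------------------------------------------------------------
-- Fields

record IsField (R : CommutativeRing c ℓ) : Set (c ⊔ ℓ) where
  open CommutativeRing R
  open AlgebraicDefinitions _≈_ using (Invertible)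
  field
    1≉0        : 1# ≉ 0#
    invertible : ∀ x → x ≉ 0# → Invertible 1# _*_ x

record FiniteField (q : ℕ) c ℓ : Set (lsuc (c ⊔ ℓ)) where
  field
    commutativeRing : CommutativeRing c ℓ
    isField         : IsField commutativeRing
  open CommutativeRing commutativeRing public
  open IsField isField public
  field
    enumeration     : Inverse setoid (≡.setoid (Fin q))

  _≟_ : Decidable _≈_
  x ≟ y with Inverse.to enumeration x Fin.≟ Inverse.to enumeration y
  ... | yes eq = yes (trans (sym (Inverse.inverseʳ enumeration ≡.refl))
                     (trans (Inverse.from-cong enumeration eq) (Inverse.inverseʳ enumeration ≡.refl)))
  ... | no neq = no λ x≈y → neq (Inverse.to-cong enumeration x≈y)

------------------------------------------------------------------------
-- Bases of subspaces

record IsBasis (K : RawRing a b) (M : RawLeftModule (RawRing.Carrier K) m ℓm)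
               (W : Pred (RawLeftModule.Carrierᴹ M) p)
               {n : ℕ} (β : Fin n → RawLeftModule.Carrierᴹ M) : Set (a ⊔ b ⊔ m ⊔ ℓm ⊔ p) where
  open RawRing K using (_≈_; 0#) renaming (Carrier to Scalar)
  open RawLeftModule M

  combination : (Fin n → Scalar) → Carrierᴹ
  combination λs = sum +ᴹ-rawMonoid (λ j → λs j *ₗ β j)

  field
    member      : ∀ j → β j ∈ W
    spanning    : ∀ x → x ∈ W → ∃[ λs ] x ≈ᴹ combination λs
    independent : ∀ λs → combination λs ≈ᴹ 0ᴹ → ∀ j → λs j ≈ 0#

  coordinates : ∀ x → x ∈ W → Fin n → Scalar
  coordinates x x∈W = proj₁ (spanning x x∈W)

HasDimension : (K : RawRing a b) (M : RawLeftModule (RawRing.Carrier K) m ℓm) →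
               Pred (RawLeftModule.Carrierᴹ M) p → ℕ → Set (a ⊔ b ⊔ m ⊔ ℓm ⊔ p)
HasDimension K M W n = ∃[ β ] IsBasis K M W {n} β

------------------------------------------------------------------------
-- Formal Laurent series in one variable

module Laurent (k : RawRing c ℓ) where
  open RawRing k

  -- The series Σ_{j ≥ 0} (digits j) z^(j - shift).
  record LaurentSeries : Set c where
    constructor laurent
    field
      shift  : ℕ
      digits : ℕ → Carrier

  extendByZero : (ℕ → Carrier) → ℤ → Carrier
  extendByZero u (+ n)      = u n
  extendByZero u (-[1+ n ]) = 0#

  coefficient : LaurentSeries → ℤ → Carrier
  coefficient (laurent N u) n = extendByZero u (n ℤ.+ + N)

  infix  4 _≈ˡ_
  infixl 6 _+ˡ_
  infixl 7 _*ˡ_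

  _≈ˡ_ : LaurentSeries → LaurentSeries → Set ℓ
  f ≈ˡ h = ∀ n → coefficient f n ≈ coefficient h n

  _+ˡ_ : LaurentSeries → LaurentSeries → LaurentSeries
  f@(laurent M _) +ˡ h@(laurent N _) =
    laurent (M ℕ.⊔ N) λ j → let n = + j ℤ.- + (M ℕ.⊔ N) in coefficient f n + coefficient h n

  _*ˡ_ : LaurentSeries → LaurentSeries → LaurentSeries
  laurent M u *ˡ laurent N w =
    laurent (M ℕ.+ N) λ n → sum +-rawMonoid {suc n} (λ j → u (toℕ j) * w (n ℕ.∸ toℕ j))

  -ˡ_ : LaurentSeries → LaurentSeries
  -ˡ laurent N u = laurent N (λ j → - u j)

  0ˡ 1ˡ zˡ : LaurentSeries
  0ˡ = laurent 0 λ _ → 0#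
  1ˡ = laurent 0 λ { zero → 1# ; (suc _) → 0# }
  zˡ = laurent 0 λ { 1 → 1# ; _ → 0# }

  laurentRing : RawRing c ℓ
  laurentRing = record
    { Carrier = LaurentSeries ; _≈_ = _≈ˡ_ ; _+_ = _+ˡ_ ; _*_ = _*ˡ_ ; -_ = -ˡ_ ; 0# = 0ˡ ; 1# = 1ˡ }

------------------------------------------------------------------------
-- Global function fields

record GlobalFunctionField {q : ℕ} (𝔽q : FiniteField q a b) c ℓ : Set (a ⊔ b ⊔ lsuc (c ⊔ ℓ)) where
  private module K = FiniteField 𝔽q
  field
    commutativeRing : CommutativeRing c ℓ
    isField         : IsField commutativeRing
  open CommutativeRing commutativeRing public
  open IsField isField public
  field
    ι               : K.Carrier → Carrier
    ι-homomorphism  : RingMorphisms.IsRingHomomorphism K.rawRing rawRing ι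

  -- Polynomials are lists of coefficients, constant term first.
  evaluate : List K.Carrier → Carrier → Carrier
  evaluate f x = foldr (λ u acc → ι u + x * acc) 0# f

  NonZeroPolynomial : List K.Carrier → Set (a ⊔ b)
  NonZeroPolynomial = Any (λ u → u K.≉ K.0#)

  Algebraic : Carrier → Set (a ⊔ b ⊔ ℓ)
  Algebraic x = ∃[ f ] NonZeroPolynomial f × evaluate f x ≈ 0#

  -- The subfield 𝔽q(x).
  RationalIn : Carrier → Pred Carrier (a ⊔ ℓ)
  RationalIn x u = ∃[ f ] ∃[ h ] evaluate h x ≉ 0# × u * evaluate h x ≈ evaluate f x

  FiniteOver : Carrier → Set (a ⊔ c ⊔ ℓ)
  FiniteOver x = ∃[ n ] Σ[ β ∈ (Fin n → Carrier) ] ∀ u →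
    Σ[ μ ∈ (Fin n → Carrier) ] (∀ j → μ j ∈ RationalIn x) × u ≈ sum +-rawMonoid (λ j → μ j * β j)

  field
    functionField     : ∃[ x ] ¬ Algebraic x × FiniteOver x
    fullConstantField : ∀ u → Algebraic u → ∃[ κ ] u ≈ ι κ

module FunctionFieldTheory {q : ℕ} {𝔽q : FiniteField q a b} (F : GlobalFunctionField 𝔽q c ℓ) where
  private module K = FiniteField 𝔽q
  open GlobalFunctionField F
  open RingMorphisms.IsRingHomomorphism ι-homomorphism using (1#-homo; -‿homo; 0#-homo; ⟦⟧-cong)
  open RingProperties ring using (-1*x≈-x; -0#≈0#)

  functionSpace : RawLeftModule K.Carrier c ℓ
  functionSpace = record
    { Carrierᴹ = Carrier ; _≈ᴹ_ = _≈_ ; _+ᴹ_ = _+_ ; _*ₗ_ = λ κ u → ι κ * u ; 0ᴹ = 0# ; -ᴹ_ = -_ }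

  ----------------------------------------------------------------------
  -- Places, given by their normalized discrete valuations

  record Place : Set (a ⊔ b ⊔ c ⊔ ℓ) where
    field
      ν             : Carrier → ℤ ⁺
      ν-cong        : ∀ {x y} → x ≈ y → ν x ≡ ν y
      ν-0           : ν 0# ≡ ⊤⁺
      ν≡∞⇒≈0        : ∀ x → ν x ≡ ⊤⁺ → x ≈ 0#
      ν-*           : ∀ x y → ν (x * y) ≡ ν x +⁺ ν y
      ν-+           : ∀ {n} x y → n ≤⁺ ν x → n ≤⁺ ν y → n ≤⁺ ν (x + y)
      ν-constant    : ∀ κ → κ K.≉ K.0# → ν (ι κ) ≡ [ + 0 ]
      ν-normalized  : ∃[ x ] ν x ≡ [ + 1 ]

  open Place public using (ν)

  infix 4 _≈ᴾ_

  _≈ᴾ_ : Place → Place → Set c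
  P ≈ᴾ Q = ∀ x → ν P x ≡ ν Q x

  IsLocalParameter : Place → Carrier → Set
  IsLocalParameter P z = ν P z ≡ [ + 1 ]

  ----------------------------------------------------------------------
  -- Residue class fields

  module ResidueClassField (P : Place) where
    open Place P hiding (ν)

    ν-1 : ν P 1# ≡ [ + 0 ]
    ν-1 = ≡.trans (ν-cong (sym 1#-homo)) (ν-constant K.1# K.1≉0)

    ≥-neg : ∀ {n} x → n ≤⁺ ν P x → n ≤⁺ ν P (- x)
    ≥-neg {n} x n≤ = ≡.subst (n ≤⁺_) (≡.sym ν-neg) n≤
      where
      -1≉0 : K.- K.1# K.≉ K.0#
      -1≉0 eq = K.1≉0 (K.trans (K.sym (RingProperties.-‿involutive K.ring K.1#))
                              (K.trans (K.-‿cong eq) (RingProperties.-0#≈0# K.ring)))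
      0+ : ∀ k → [ + 0 ] +⁺ k ≡ k
      0+ [ k ] = ≡.cong [_] (ℤ.+-identityˡ k)
      0+ ⊤⁺    = ≡.refl
      ν-neg : ν P (- x) ≡ ν P x
      ν-neg = ≡.trans (ν-cong (sym (trans (*-congʳ (trans (-‿homo K.1#) (-‿cong 1#-homo))) (-1*x≈-x x))))
              (≡.trans (ν-* (ι (K.- K.1#)) x)
              (≡.trans (≡.cong (_+⁺ ν P x) (ν-constant _ -1≉0)) (0+ (ν P x))))

    ≥-* : ∀ x y → [ + 0 ] ≤⁺ ν P x → [ + 0 ] ≤⁺ ν P y → [ + 0 ] ≤⁺ ν P (x * y)
    ≥-* x y 0≤x 0≤y = ≡.subst ([ + 0 ] ≤⁺_) (≡.sym (ν-* x y)) (add 0≤x 0≤y)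
      where
      add : ∀ {k n} → [ + 0 ] ≤⁺ k → [ + 0 ] ≤⁺ n → [ + 0 ] ≤⁺ k +⁺ n
      add [ i ]≤     [ j ]≤     = [ ℤ.+-mono-≤ i j ]≤
      add [ i ]≤     (_ ≤⊤⁺)    = _ ≤⊤⁺
      add (_ ≤⊤⁺)    _          = _ ≤⊤⁺

    ≥-0 : ∀ n → n ≤⁺ ν P 0#
    ≥-0 n = ≡.subst (n ≤⁺_) (≡.sym ν-0) (n ≤⊤⁺)

    ≥-constant : ∀ κ → [ + 0 ] ≤⁺ ν P (ι κ)
    ≥-constant κ with κ K.≟ K.0#
    ... | yes κ≈0 = ≡.subst ([ + 0 ] ≤⁺_) (ν-cong (sym (trans (⟦⟧-cong κ≈0) 0#-homo))) (≥-0 _)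
    ... | no  κ≉0 = ≡.subst ([ + 0 ] ≤⁺_) (≡.sym (ν-constant κ κ≉0)) [ ℤ.≤-refl ]≤

    -- The valuation ring; two elements are identified when they agree
    -- modulo the maximal ideal.
    ValuationRing : Set c
    ValuationRing = Σ[ x ∈ Carrier ] [ + 0 ] ≤⁺ ν P x

    residueField : RawRing c (Level.zero)
    residueField = record
      { Carrier = ValuationRing
      ; _≈_     = λ (x , _) (y , _) → [ + 1 ] ≤⁺ ν P (x - y)
      ; _+_     = λ (x , x≥0) (y , y≥0) → x + y , ν-+ x y x≥0 y≥0
      ; _*_     = λ (x , x≥0) (y , y≥0) → x * y , ≥-* x y x≥0 y≥0
      ; -_      = λ (x , x≥0) → - x , ≥-neg x x≥0
      ; 0#      = 0# , ≥-0 _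
      ; 1#      = 1# , ≡.subst ([ + 0 ] ≤⁺_) (≡.sym ν-1) [ ℤ.≤-refl ]≤
      }

    residueSpace : RawLeftModule K.Carrier c (Level.zero)
    residueSpace = record
      { Carrierᴹ = k.Carrier ; _≈ᴹ_ = k._≈_ ; _+ᴹ_ = k._+_ ; 0ᴹ = k.0# ; -ᴹ_ = k.-_
      ; _*ₗ_ = λ κ (x , x≥0) → ι κ * x , ≥-* (ι κ) x (≥-constant κ) x≥0 }
      where module k = RawRing residueField

  open ResidueClassField public using (ValuationRing; residueField; residueSpace)

  IsResidueBasis : (P : Place) {n : ℕ} → (Fin n → ValuationRing P) → Set (a ⊔ b ⊔ c)
  IsResidueBasis P = IsBasis K.rawRing (residueSpace P) U

  HasDegree : Place → ℕ → Set (a ⊔ b ⊔ c)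
  HasDegree P = HasDimension K.rawRing (residueSpace P) U

  degree-nonZero : ∀ {P n} → HasDegree P n → NonZero n
  degree-nonZero {P} {suc n} _ = _
  degree-nonZero {P} {zero} (_ , isBasis) = ⊥-elim (absurd (≡.subst ([ + 1 ] ≤⁺_)
      (≡.trans (Place.ν-cong P (trans (+-congˡ -0#≈0#) (+-identityʳ 1#))) (ResidueClassField.ν-1 P))
      (proj₂ (IsBasis.spanning isBasis (RawRing.1# (residueField P)) tt))))
    where
    absurd : ¬ [ + 1 ] ≤⁺ [ + 0 ]
    absurd [ ℤ.+≤+ () ]≤

  ----------------------------------------------------------------------
  -- Divisors and Riemann–Roch spaces

  -- Formal ℤ-linear combinations of places. A place may occur more than
  -- once; its coefficients then add up.
  Divisor : Set (a ⊔ b ⊔ c ⊔ ℓ)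
  Divisor = List (ℤ × Place)

  -- A relation rather than a function, so as not to assume a decision
  -- procedure for equality of places.
  data HasCoefficient : Divisor → Place → ℤ → Set (a ⊔ b ⊔ c ⊔ ℓ) where
    []    : ∀ {Q} → HasCoefficient [] Q (+ 0)
    here  : ∀ {n P D Q k} → P ≈ᴾ Q → HasCoefficient D Q k → HasCoefficient ((n , P) ∷ D) Q (n ℤ.+ k)
    there : ∀ {n P D Q k} → ¬ P ≈ᴾ Q → HasCoefficient D Q k → HasCoefficient ((n , P) ∷ D) Q k

  data HasDegreeᴰ : Divisor → ℤ → Set (a ⊔ b ⊔ c ⊔ ℓ) where
    []  : HasDegreeᴰ [] (+ 0)
    _∷_ : ∀ {n P D e d} → HasDegree P e → HasDegreeᴰ D d → HasDegreeᴰ ((n , P) ∷ D) (n ℤ.* + e ℤ.+ d)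

  𝓛 : Divisor → Pred Carrier (a ⊔ b ⊔ c ⊔ ℓ)
  𝓛 D x = x ≈ 0# ⊎ (x ≉ 0# × (∀ Q k → HasCoefficient D Q k → [ + 0 ] ≤⁺ ν Q x +⁺ [ k ]))

  HasDimension𝓛 : Divisor → ℕ → Set (a ⊔ b ⊔ c ⊔ ℓ)
  HasDimension𝓛 D = HasDimension K.rawRing functionSpace (𝓛 D)

  -- The genus is the maximum of deg D - ℓ(D) + 1 over all divisors D.
  record HasGenus (g : ℕ) : Set (a ⊔ b ⊔ c ⊔ ℓ) where
    field
      bound    : ∀ D d n → HasDegreeᴰ D d → HasDimension𝓛 D n → d ℤ.- + n ℤ.+ + 1 ℤ.≤ + g
      attained : ∃[ D ] ∃[ d ] ∃[ n ] HasDegreeᴰ D d × HasDimension𝓛 D n × d ℤ.- + n ℤ.+ + 1 ≡ + g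

  infix 7 _·_

  _·_ : ℤ → Place → Divisor
  n · P = (n , P) ∷ []

  IsGap : Place → ℕ → Set (a ⊔ b ⊔ c ⊔ ℓ)
  IsGap P n = 1 ℕ.≤ n × (∃[ d ] HasDimension𝓛 (+ n · P) d × HasDimension𝓛 ((+ n ℤ.- + 1) · P) d)

  ----------------------------------------------------------------------
  -- Local expansions

  -- The identification of the completion of F at P with the Laurent
  -- series field k((z)) over the residue field k, restricted to F. The
  -- image of F is dense in k((z)) with the valuation of k((z)) inducing
  -- that of P, so this exhibits k((z)) as the completion. The conditions
  -- determine the map: k sits in k((z)) as the constants.
  record LocalExpansion (P : Place) (z : Carrier) : Set (c ⊔ ℓ) where
    open Laurent (residueField P) public
    open RawRing (residueField P) using () renaming (_≈_ to _≈ᵏ_; 0# to 0ᵏ)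
    field
      expand               : Carrier → LaurentSeries
      expand-homomorphism  : RingMorphisms.IsRingHomomorphism rawRing laurentRing expand
      expand-parameter     : expand z ≈ˡ zˡ
      expand-valuation     : ∀ x n → [ n ] ≤⁺ ν P x ⇔ (∀ k → k ℤ.< n → coefficient (expand x) k ≈ᵏ 0ᵏ)
      expand-residue       : ∀ (x : ValuationRing P) → coefficient (expand (proj₁ x)) (+ 0) ≈ᵏ x

  ----------------------------------------------------------------------
  -- The refined columnwise construction

  record RefinedConstruction (g : ℕ) (P∞ : Place) {s : ℕ} (P : Fin s → Place)
                             (e : Fin s → ℕ) (P-degree : ∀ i → HasDegree (P i) (e i))
                             : Set (a ⊔ b ⊔ c ⊔ ℓ) where
    v : ℕ
    v = lcms e

    instance
      e-nonZero : ∀ {i} → NonZero (e i)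
      e-nonZero {i} = degree-nonZero (P-degree i)

    -- n P∞ - Σ_i (l_i + ⋯ + l_s) (v / e_i) P_i
    D : ℕ → (Fin s → ℕ) → Divisor
    D n l = (+ n , P∞) ∷ tabulate (λ i → (ℤ.- (+ (tailSum l i ℕ.* (v / e i))) , P i))

    field
      n              : ℕ → ℕ
      n-increasing   : ∀ r → n r ℕ.< n (suc r)
      n-nonGap       : ∀ r → ¬ IsGap P∞ (n r)
      n-exhaustive   : ∀ k → ¬ IsGap P∞ k → ∃[ r ] n r ≡ k

      y              : ℕ → Carrier
      y-initial      : ∀ r → r ℕ.≤ g → y r ∈ 𝓛 (+ n r · P∞) ∖ 𝓛 ((+ n r ℤ.- + 1) · P∞)
      division       : ∀ r → g ℕ.< r → SuccessiveDivision s v (r ℕ.∸ g)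
      y-later        : ∀ r (g<r : g ℕ.< r) → let open SuccessiveDivision (division r g<r) in
                       y r ∈ 𝓛 (D (n r) l) ∖ 𝓛 (D (n (r ℕ.∸ 1)) l)

      z              : Fin s → Carrier
      z-parameter    : ∀ i → IsLocalParameter (P i) (z i)
      expansion      : ∀ i → LocalExpansion (P i) (z i)

      basis          : ∀ i → Fin (e i) → ValuationRing (P i)
      basis-isBasis  : ∀ i → IsResidueBasis (P i) (basis i)

    β : ∀ i → ℕ → ℕ → ValuationRing (P i)
    β i k r = coefficient (expand (y r)) (+ k)
      where open LocalExpansion (expansion i)

    -- Rows are numbered from 1: row k e_i + h with 1 ≤ h ≤ e_i holds the
    -- h-th coordinates of the k-th coefficients. The value at row 0 is
    -- irrelevant.
    C : Fin s → ℕ → ℕ → K.Carrier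
    C i j r = IsBasis.coordinates (basis-isBasis i) (β i ((j ℕ.∸ 1) / e i) r) tt ((j ℕ.∸ 1) mod e i)

------------------------------------------------------------------------
-- Rows

-- l is the length of the row u, which in particular has only finitely
-- many nonzero entries.
HasLength : {q : ℕ} (𝔽q : FiniteField q a b) → (ℕ → FiniteField.Carrier 𝔽q) → ℕ → Set b
HasLength 𝔽q u l =
    (l ≡ 0 × (∀ r → u r ≈ 0#))
  ⊎ (∃[ m ] l ≡ suc m × u m ≉ 0# × (∀ r → u r ≉ 0# → suc r ℕ.≤ l))
  where open FiniteField 𝔽q

{-# OPTIONS --safe #-}

-- If D_r contains the coefficient - t v / e_i at P_i, then ν_{P_i}(y_r) ≥ t v / e_i, so column r
-- of C^(i) starts with at least t v zeros, where t = l_i + ⋯ + l_s. Unwinding the divisions,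
-- r - g = Σ_{j ≥ i} j v l_j + w_i < s v t + i v, so t exceeds ⌊(d - 1) / v⌋ as soon as
-- r ≥ g + s v ⌊(d - 1) / v⌋ + i v.

module Submission where

open import Defs
open import Level using (Level)
open import Algebra using (RawRing; Group)
import Algebra.Properties.Group as GroupProperties
import Algebra.Properties.Ring as RingProperties
open import Data.Fin using (Fin; zero; suc; toℕ; fromℕ; inject₁)
open import Data.Fin.Properties using (toℕ<n; suc-injective)
open import Data.Integer as ℤ using (ℤ; +_)
import Data.Integer.Properties as ℤ
open import Data.List using (tabulate)
open import Data.Nat using (ℕ; zero; suc; z≤n; NonZero; >-nonZero⁻¹; _+_; _*_; _∸_; _≤_; _<_)
open import Data.Nat.Divisibility using (_∣_; ∣-trans)
open import Data.Nat.DivMod using (_/_; m≡m%n+[m/n]*n; m%n<n; m<n*o⇒m/o<n; m/n*n≡m)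
open import Data.Nat.LCM using (m∣lcm[m,n]; n∣lcm[m,n])
open import Data.Nat.Properties
  using (≤-refl; ≤-trans; <-irrefl; <-≤-trans; ≰⇒>; m≤n+m; m≤m+n; m<m+n; m≤n⇒m≤1+n; m≤n⇒m<n∨m≡n;
         m+n≤o⇒m≤o∸n; +-assoc; +-comm; +-monoʳ-≤; +-monoˡ-≤; +-monoʳ-<; +-monoˡ-<;
         *-assoc; *-comm; *-distribˡ-+; *-monoʳ-≤; *-monoˡ-≤; module ≤-Reasoning)
open import Data.Product using (_×_; _,_; ∃-syntax; proj₁; proj₂)
open import Data.Sum using (inj₁; inj₂)
open import Data.Unit using (tt)
import Data.Vec.Functional as Vector
open import Function using (_∘_; Equivalence)
open import Relation.Binary.PropositionalEquality as ≡ using (_≡_; refl)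
open import Relation.Nullary using (¬_; yes; no; contradiction)
open import Relation.Nullary.Construct.Add.Supremum using (⊤⁺; [_])
open import Relation.Unary using (_∈_)

private
  variable
    a b c ℓ : Level

∣lcms : ∀ {s} (e : Fin s → ℕ) i → e i ∣ lcms e
∣lcms e zero    = m∣lcm[m,n] (e zero) _
∣lcms e (suc i) = ∣-trans (∣lcms (e ∘ suc) i) (n∣lcm[m,n] (e zero) _)

m<n*[1+m/n] : ∀ m n .⦃ _ : NonZero n ⦄ → m < n * suc (m / n)
m<n*[1+m/n] m n = begin-strict
  m                     ≡⟨ m≡m%n+[m/n]*n m n ⟩
  _ + m / n * n         <⟨ +-monoˡ-< (m / n * n) (m%n<n m n) ⟩
  suc (m / n) * n       ≡⟨ *-comm (suc (m / n)) n ⟩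
  n * suc (m / n)       ∎
  where open ≤-Reasoning

-- The steps telescope, and each contributes `c j * l j ≤ M * l j`. The coefficients `c` are left
-- arbitrary because the induction drops index zero: a family of the form `suc (toℕ j) * v` would
-- not keep its form under this shift.
iterated-step-sum : ∀ {s} M (c l : Fin s → ℕ) (w : Fin (suc s) → ℕ) → (∀ j → c j ≤ M) →
  (∀ j → w (suc j) ≡ c j * l j + w (inject₁ j)) →
  w (fromℕ s) ≤ M * Vector.foldr _+_ 0 l + w zero
iterated-step-sum {zero}  M c l w c≤M step = m≤n+m (w zero) (M * 0)
iterated-step-sum {suc s} M c l w c≤M step = begin
  w (fromℕ (suc s))                      ≤⟨ iterated-step-sum M (c ∘ suc) (l ∘ suc) (w ∘ suc) (c≤M ∘ suc) (step ∘ suc) ⟩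
  M * Σl + w (suc zero)                  ≡⟨ ≡.cong (_+_ (M * Σl)) (step zero) ⟩
  M * Σl + (c zero * l zero + w zero)    ≤⟨ +-monoʳ-≤ (M * Σl) (+-monoˡ-≤ (w zero) (*-monoˡ-≤ (l zero) (c≤M zero))) ⟩
  M * Σl + (M * l zero + w zero)         ≡⟨ +-assoc (M * Σl) (M * l zero) (w zero) ⟨
  M * Σl + M * l zero + w zero           ≡⟨ ≡.cong (_+ w zero) (*-distribˡ-+ M Σl (l zero)) ⟨
  M * (Σl + l zero) + w zero             ≡⟨ ≡.cong (λ t → M * t + w zero) (+-comm Σl (l zero)) ⟩
  M * (l zero + Σl) + w zero             ∎
  where
  open ≤-Reasoning
  Σl = Vector.foldr _+_ 0 (l ∘ suc)

-- Stop the telescoping at index `i`: discarding the smaller indices leaves the top value of `w` in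
-- place and turns the tail sum into a full sum.
iterated-step-tailSum : ∀ {s} M (c l : Fin s → ℕ) (w : Fin (suc s) → ℕ) → (∀ j → c j ≤ M) →
  (∀ j → w (suc j) ≡ c j * l j + w (inject₁ j)) →
  ∀ i → w (fromℕ s) ≤ M * tailSum l i + w (inject₁ i)
iterated-step-tailSum M c l w c≤M step zero    = iterated-step-sum M c l w c≤M step
iterated-step-tailSum M c l w c≤M step (suc i) =
  iterated-step-tailSum M (c ∘ suc) (l ∘ suc) (w ∘ suc) (c≤M ∘ suc) (step ∘ suc) i

tailSum-lowerBound : ∀ {s v n} (division : SuccessiveDivision s v n) (i : Fin s) Q →
  s * v * Q + suc (toℕ i) * v ≤ n → Q < tailSum (SuccessiveDivision.l division) i
tailSum-lowerBound {s} {v} {n} division i Q large = ≰⇒> λ t≤Q → <-irrefl refl (begin-strict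
  n                                     ≡⟨ start ⟨
  -- The common bound is `M = s * v`, since every divisor `suc (toℕ j) * v` is at most `s * v`.
  w (fromℕ s)                           ≤⟨ iterated-step-tailSum (s * v) _ l w (λ j → *-monoˡ-≤ v (toℕ<n j)) step i ⟩
  s * v * tailSum l i + w (inject₁ i)   ≤⟨ +-monoˡ-≤ _ (*-monoʳ-≤ (s * v) t≤Q) ⟩
  s * v * Q + w (inject₁ i)             <⟨ +-monoʳ-< (s * v * Q) (w-bound i) ⟩
  s * v * Q + suc (toℕ i) * v           ≤⟨ large ⟩
  n                                     ∎)
  where
  open SuccessiveDivision division
  open ≤-Reasoning hiding (start)

0≤x-k⇒k≤x : ∀ x k → [ + 0 ] ≤⁺ x +⁺ [ ℤ.- k ] → [ k ] ≤⁺ x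
0≤x-k⇒k≤x [ x ] k [ 0≤x-k ]≤ = [ ℤ.0≤i-j⇒j≤i 0≤x-k ]≤
0≤x-k⇒k≤x ⊤⁺    k _           = [ k ] ≤⊤⁺

module _ {q} (𝔽q : FiniteField q a b) where
  open FiniteField 𝔽q using (Carrier; _≈_; 0#; _≟_)

  -- Equality in a finite field is decidable, so the last nonzero entry can be searched for
  -- downwards from `N`.
  eventuallyZero⇒hasLength : ∀ (u : ℕ → Carrier) N → (∀ r → N ≤ r → u r ≈ 0#) →
                             ∃[ l ] HasLength 𝔽q u l × l ≤ N
  eventuallyZero⇒hasLength u zero    vanish = 0 , inj₁ (refl , λ r → vanish r z≤n) , z≤n
  eventuallyZero⇒hasLength u (suc N) vanish with u N ≟ 0#
  ... | no uN≉0  = suc N , inj₂ (N , refl , uN≉0 , λ r ur≉0 → ≰⇒> λ N<r → ur≉0 (vanish r N<r)) , ≤-refl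
  ... | yes uN≈0 = l , hasLength , m≤n⇒m≤1+n l≤N
    where
    vanish′ : ∀ r → N ≤ r → u r ≈ 0#
    vanish′ r N≤r with m≤n⇒m<n∨m≡n N≤r
    ... | inj₁ N<r  = vanish r N<r
    ... | inj₂ refl = uN≈0
    shorter = eventuallyZero⇒hasLength u N vanish′
    l         = proj₁ shorter
    hasLength = proj₁ (proj₂ shorter)
    l≤N       = proj₂ (proj₂ shorter)

module _ (G : Group a ℓ) where
  open Group G

  -- Serves for transitivity of congruence modulo the maximal ideal.
  //-telescope : ∀ x y z → x // z ≈ (x // y) ∙ (y // z)
  //-telescope x y z = sym (trans (sym (assoc (x // y) y (z ⁻¹))) (∙-congʳ (//-rightDividesˡ y x)))
    where open GroupProperties G

module _ {q} {𝔽q : FiniteField q a b} (F : GlobalFunctionField 𝔽q c ℓ) where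
  private module K = FiniteField 𝔽q
  open GlobalFunctionField F using (ring; +-group; sym)
  open FunctionFieldTheory F

  hasCoefficient-tabulate-absent : ∀ {s} (m : Fin s → ℤ) (P : Fin s → Place) Q →
    (∀ j → ¬ P j ≈ᴾ Q) → HasCoefficient (tabulate (λ j → m j , P j)) Q (+ 0)
  hasCoefficient-tabulate-absent {zero}  m P Q P≉Q = []
  hasCoefficient-tabulate-absent {suc s} m P Q P≉Q =
    there (P≉Q zero) (hasCoefficient-tabulate-absent (m ∘ suc) (P ∘ suc) Q (P≉Q ∘ suc))

  hasCoefficient-tabulate : ∀ {s} (m : Fin s → ℤ) (P : Fin s → Place) →
    (∀ i j → P i ≈ᴾ P j → i ≡ j) → ∀ i → HasCoefficient (tabulate (λ j → m j , P j)) (P i) (m i)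
  hasCoefficient-tabulate m P P-inj zero =
    -- Distinctness of the places makes this the only hit, so the coefficient comes out as `m zero`
    -- plus 0.
    ≡.subst (HasCoefficient _ _) (ℤ.+-identityʳ (m zero)) (here (λ _ → refl)
      (hasCoefficient-tabulate-absent (m ∘ suc) (P ∘ suc) (P zero) λ j eq → contradiction (P-inj _ _ eq) λ ()))
  hasCoefficient-tabulate m P P-inj (suc i) =
    there (λ eq → contradiction (P-inj _ _ eq) λ ())
      (hasCoefficient-tabulate (m ∘ suc) (P ∘ suc) (λ j k eq → suc-injective (P-inj _ _ eq)) i)

  ∈𝓛⇒ν-bound : ∀ {D Q x} k → x ∈ 𝓛 D → HasCoefficient D Q (ℤ.- k) → [ k ] ≤⁺ ν Q x
  ∈𝓛⇒ν-bound {Q = Q} k (inj₁ x≈0) _ =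
    ≡.subst ([ k ] ≤⁺_) (≡.sym (≡.trans (Place.ν-cong Q x≈0) (Place.ν-0 Q))) ([ k ] ≤⊤⁺)
  ∈𝓛⇒ν-bound {Q = Q} {x} k (inj₂ (_ , bounds)) coeff = 0≤x-k⇒k≤x (ν Q x) k (bounds Q (ℤ.- k) coeff)

  module _ (P : Place) where
    open RawRing (residueField P) using () renaming (Carrier to k; _≈_ to _≈ᵏ_; 0# to 0ᵏ)

    ≈ᵏ-sym : ∀ {x y : k} → x ≈ᵏ y → y ≈ᵏ x
    ≈ᵏ-sym {x , _} {y , _} x≈y = ≡.subst (_ ≤⁺_) (Place.ν-cong P (RingProperties.⁻¹-anti-homo‿- ring x y))
      (ResidueClassField.≥-neg P _ x≈y)

    ≈ᵏ-trans : ∀ {x y z : k} → x ≈ᵏ y → y ≈ᵏ z → x ≈ᵏ z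
    ≈ᵏ-trans {x , _} {y , _} {z , _} x≈y y≈z = ≡.subst (_ ≤⁺_)
      (Place.ν-cong P (sym (//-telescope +-group x y z))) (Place.ν-+ P _ _ x≈y y≈z)

    -- The coordinates are whatever witness `spanning` supplies. Their combination is congruent to
    -- `x`, hence to 0, and linear independence then forces each of them to vanish.
    coordinates-0 : ∀ {n} {β : Fin n → ValuationRing P} (isBasis : IsResidueBasis P β) x →
                    x ≈ᵏ 0ᵏ → ∀ j → IsBasis.coordinates isBasis x tt j K.≈ K.0#
    coordinates-0 isBasis x x≈0 =
      independent μ (≈ᵏ-trans {combination μ} {x} {0ᵏ} (≈ᵏ-sym {x} {combination μ} (proj₂ (spanning x tt))) x≈0)
      where
      open IsBasis isBasis
      μ = coordinates x tt

  module _ {g P∞ s} {P : Fin s → Place} {e} {P-degree : ∀ i → HasDegree (P i) (e i)}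
           (P∞≉P : ∀ i → ¬ (P∞ ≈ᴾ P i)) (P-inj : ∀ i j → P i ≈ᴾ P j → i ≡ j)
           (construction : RefinedConstruction g P∞ P e P-degree) where
    open RefinedConstruction construction

    private instance
      v-nonZero : NonZero v
      v-nonZero = lcms-nonZero e (λ i → degree-nonZero (P-degree i))

    C-vanishes : ∀ i d r → g + s * v * ((d ∸ 1) / v) + suc (toℕ i) * v ≤ r → C i d r K.≈ K.0#
    C-vanishes i d r large =
      coordinates-0 (P i) (basis-isBasis i) (β i ((d ∸ 1) / e i) r)
        -- Row `d` reads the expansion coefficient with index `(d ∸ 1) / e i`, which lies below the
        -- valuation of `y r`.
        (Equivalence.to (expand-valuation (y r) (+ (t * (v / e i)))) ν-bound _ (ℤ.+<+ k<)) _
      where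
      open LocalExpansion (expansion i)
      Q = (d ∸ 1) / v
      offset = s * v * Q + suc (toℕ i) * v

      g+offset≤r : g + offset ≤ r
      g+offset≤r = ≡.subst (_≤ r) (+-assoc g (s * v * Q) _) large

      g<r : g < r
      -- The summand `suc (toℕ i) * v` is positive, so `r` is past the initial columns and `y-later`
      -- applies.
      g<r = <-≤-trans (m<m+n g (<-≤-trans (>-nonZero⁻¹ v)
              (≤-trans (m≤m+n v _) (m≤n+m _ (s * v * Q))))) g+offset≤r

      open SuccessiveDivision (division r g<r) using (l)
      t = tailSum l i

      Q<t : Q < t
      Q<t = tailSum-lowerBound (division r g<r) i Q
              (m+n≤o⇒m≤o∸n offset (≡.subst (_≤ r) (+-comm g offset) g+offset≤r))

      k< : (d ∸ 1) / e i < t * (v / e i)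
      k< = m<n*o⇒m/o<n (begin-strict
        d ∸ 1                   <⟨ m<n*[1+m/n] (d ∸ 1) v ⟩
        v * suc Q               ≤⟨ *-monoʳ-≤ v Q<t ⟩
        v * t                   ≡⟨ *-comm v t ⟩
        -- Since `e i` divides `v`, the quotient `v / e i` is exact; this converts a count of rows
        -- into a count of blocks of `e i` rows.
        t * v                   ≡⟨ ≡.cong (t *_) (m/n*n≡m (∣lcms e i)) ⟨
        t * (v / e i * e i)     ≡⟨ *-assoc t (v / e i) (e i) ⟨
        t * (v / e i) * e i     ∎)
        where open ≤-Reasoning

      ν-bound : [ + (t * (v / e i)) ] ≤⁺ ν (P i) (y r)
      ν-bound = ∈𝓛⇒ν-bound (+ (t * (v / e i))) (proj₁ (y-later r g<r))
        -- The term at `P∞` contributes nothing at `P i`, so only the negative coefficient from the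
        -- tabulated part remains.
        (there (P∞≉P i) (hasCoefficient-tabulate _ P P-inj i))

theorem2 : ∀ {a b c ℓ : Level} (q : ℕ) → IsPrimePower q →
    (𝔽q : FiniteField q a b) (F : GlobalFunctionField 𝔽q c ℓ) → let open FunctionFieldTheory F in
    (s : ℕ) → 1 ≤ s → (g : ℕ) → HasGenus g →
    (P∞ : Place) (P : Fin s → Place) →
    (∀ i → ¬ (P∞ ≈ᴾ P i)) → (∀ i j → P i ≈ᴾ P j → i ≡ j) →
    HasDegree P∞ 1 →
    (e : Fin s → ℕ) (P-degree : ∀ i → HasDegree (P i) (e i)) →
    (construction : RefinedConstruction g P∞ P e P-degree) →
    let open RefinedConstruction construction using (C)
        v = lcms e
        instance v-nonZero = lcms-nonZero e (λ i → degree-nonZero (P-degree i)) in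
    (i : Fin s) (d : ℕ) → 1 ≤ d →
    ∃[ l ] HasLength 𝔽q (C i d) l × l ≤ g + s * v * ((d ∸ 1) / v) + suc (toℕ i) * v
theorem2 q _ 𝔽q F s _ g _ P∞ P P∞≉P P-inj _ e P-degree construction i d _ =
  eventuallyZero⇒hasLength 𝔽q (C i d) _ (C-vanishes F P∞≉P P-inj construction i d)
  where open FunctionFieldTheory.RefinedConstruction construction using (C)
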